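{- Let $R$ be a ring (unital and associative, not necessarily commutative). Let $n$ be a positive integer and $p\in\mathbb{N}$. Let $h_{k,\,i}$ be an element of $R$ for all $k\in\mathbb{Z}$ and $i\in[n]$. For any $\alpha\in\mathbb{Z}^n$, define $$t_\alpha:=\operatorname{rowdet}\left(\left(h_{\alpha_i+j,\,i}\right)_{i,j\in[n]}\right)\in R.$$ Let $\eta$ be the $n$-tuple $$(1,2,\ldots,n)+(\underbrace{0,0,\ldots,0}_{n-1\text{ zeroes}},p)=(1,2,\ldots,n-1,n+p)\in\mathbb{Z}^n.$$ Let $\alpha\in\mathbb{Z}^n$. Then $$\sum_{\substack{\beta\in\mathbb{N}^n;\\ |\beta|=p}}t_{\alpha+\beta}=\operatorname{rowdet}\left(\left(h_{\alpha_i+\eta_j,\,i}\right)_{i,j\in[n]}\right).$$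
   Context: $\mathbb{N}=\{0,1,2,\ldots\}$ and $[n]=\{1,2,\ldots,n\}$. For an $n$-tuple $\alpha$, $\alpha_i$ denotes its $i$-th entry, and for $\alpha\in\mathbb{Z}^n$ we set $|\alpha|:=\alpha_1+\alpha_2+\cdots+\alpha_n$. Addition of $n$-tuples is entrywise. $S_n$ is the group of permutations of $[n]$, and $(-1)^\sigma$ is the sign of $\sigma\in S_n$. For an $n\times n$-matrix $A=(a_{i,j})_{i,j\in[n]}$ over $R$ (whose $(i,j)$-th entry is $a_{i,j}$), the row-determinant is $$\operatorname{rowdet}A:=\sum_{\sigma\in S_n}(-1)^\sigma a_{1,\sigma(1)}a_{2,\sigma(2)}\cdots a_{n,\sigma(n)}\in R$$ (factors multiplied in this order). -}

module Defs where

open import Algebra.Bundles using (Ring; Semiring)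
open import Data.Bool.Base using (if_then_else_)
open import Data.Fin.Base using (Fin; zero; suc; toℕ; punchIn)
open import Data.Fin.Properties as Fin using (punchIn-injective)
open import Data.Fin.Permutation as Perm
  using (Permutation′; _⟨$⟩ʳ_; insert; remove; insert-remove)
open import Data.Integer.Base as ℤ using (ℤ; +_)
open import Data.List.Base as List
  using (List; []; _∷_; [_]; length; filter; cartesianProduct; allFin; upTo; concatMap)
open import Data.List.Membership.Propositional using (_∈_; find; lose)
open import Data.List.Membership.Propositional.Properties
  using (∈-allFin; ∈-upTo⁺; ∈-upTo⁻; ∈-map⁺; ∈-map⁻; ∈-concatMap⁺; ∈-concatMap⁻)
open import Data.List.Relation.Unary.All as All using (All)
import Data.List.Relation.Unary.All.Properties as All
open import Data.List.Relation.Unary.AllPairs as AllPairs using (AllPairs; []; _∷_)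
import Data.List.Relation.Unary.AllPairs.Properties as AllPairs
open import Data.List.Relation.Unary.Any as Any using (Any; here)
import Data.List.Relation.Unary.Any.Properties as Any
open import Data.List.Relation.Unary.Unique.Propositional using (Unique)
open import Data.List.Relation.Unary.Unique.Propositional.Properties using (allFin⁺; upTo⁺)
open import Data.Nat.Base as ℕ using (ℕ; zero; suc; s≤s; s≤s⁻¹; _∸_)
open import Data.Nat.Properties as ℕ using (m≤m+n; m+n∸m≡n; m+[n∸m]≡n)
open import Data.Product.Base using (_,_)
open import Data.Vec.Base as Vec using (Vec; []; _∷_; lookup)
open import Data.Vec.Properties using (∷-injectiveˡ; ∷-injectiveʳ)
open import Data.Vec.Functional using (Vector; zipWith)
open import Function.Base using (_∘_)
open import Relation.Binary.PropositionalEquality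
  using (_≡_; refl; sym; trans; cong)
open import Relation.Nullary.Decidable using (does; _×-dec_)
open import Relation.Nullary.Negation using (¬_)

-- The index set [n] = {1,…,n} is Fin n, with i standing for ⟦ i ⟧.
⟦_⟧ : ∀ {n} → Fin n → ℕ
⟦ i ⟧ = suc (toℕ i)

-- A permutation of Fin (suc n) is determined by the image j of zero and
-- the permutation of Fin n left after deleting zero and j; see
-- permutations-complete and permutations-unique.
permutations : ∀ n → List (Permutation′ n)
permutations zero    = [ Perm.id ]
permutations (suc n) =
  concatMap (λ j → List.map (insert zero j) (permutations n)) (allFin (suc n))

inversions : ∀ {n} → Permutation′ n → ℕ
inversions {n} σ = length (filter
  (λ (i , j) → i Fin.<? j ×-dec (σ ⟨$⟩ʳ j) Fin.<? (σ ⟨$⟩ʳ i))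
  (cartesianProduct (allFin n) (allFin n)))

private
  insert-cong : ∀ {n} (j : Fin (suc n)) {σ τ : Permutation′ n} →
                σ Perm.≈ τ → insert zero j σ Perm.≈ insert zero j τ
  insert-cong j σ≈τ zero    = refl
  insert-cong j σ≈τ (suc i) = cong (punchIn j) (σ≈τ i)

  insert-injective : ∀ {n} (j : Fin (suc n)) {σ τ : Permutation′ n} →
                     insert zero j σ Perm.≈ insert zero j τ → σ Perm.≈ τ
  insert-injective j e i = punchIn-injective j _ _ (e (suc i))

permutations-complete : ∀ {n} (σ : Permutation′ n) → Any (σ Perm.≈_) (permutations n)
permutations-complete {zero}  σ = here λ ()
permutations-complete {suc n} σ = Any.concatMap⁺ _
  (lose (∈-allFin (σ ⟨$⟩ʳ zero))
    (Any.map⁺ (Any.map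
      (λ {τ} e i → trans (sym (insert-remove zero σ i))
                         (insert-cong (σ ⟨$⟩ʳ zero) {remove zero σ} {τ} e i))
      (permutations-complete (remove zero σ)))))

permutations-unique : ∀ n → AllPairs (λ σ τ → ¬ (σ Perm.≈ τ)) (permutations n)
permutations-unique zero    = All.[] ∷ []
permutations-unique (suc n) = AllPairs.concat⁺
  (All.map⁺ (All.universal
    (λ j → AllPairs.map⁺ (AllPairs.map
      (λ {σ} {τ} σ≉τ e → σ≉τ (insert-injective j {σ} {τ} e))
      (permutations-unique n)))
    (allFin (suc n))))
  (AllPairs.map⁺ (AllPairs.map
    (λ j≢k → All.map⁺ (All.universal
      (λ σ → All.map⁺ (All.universal (λ τ e → j≢k (e zero)) _)) _))
    (allFin⁺ (suc n))))

-- All β ∈ ℕⁿ with |β| = p: the head k ranges over 0,…,p and the tail has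
-- sum p ∸ k; see ∈-compositions⁺, ∈-compositions⁻ and compositions-unique.
compositions : ∀ n → ℕ → List (Vec ℕ n)
compositions zero    zero    = [ [] ]
compositions zero    (suc p) = []
compositions (suc n) p       =
  concatMap (λ k → List.map (k ∷_) (compositions n (p ∸ k))) (upTo (suc p))

∈-compositions⁺ : ∀ {n} p (β : Vec ℕ n) → Vec.sum β ≡ p → β ∈ compositions n p
∈-compositions⁺ _ []      refl = here refl
∈-compositions⁺ _ (k ∷ β) refl = ∈-concatMap⁺ _
  (lose (∈-upTo⁺ (s≤s (m≤m+n k (Vec.sum β))))
    (∈-map⁺ (k ∷_) (∈-compositions⁺ _ β (sym (m+n∸m≡n k (Vec.sum β))))))

∈-compositions⁻ : ∀ {n} p (β : Vec ℕ n) → β ∈ compositions n p → Vec.sum β ≡ p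
∈-compositions⁻ {zero}  zero [] _ = refl
∈-compositions⁻ {suc n} p    β  β∈
  with k , k∈ , β∈k ← find
         (∈-concatMap⁻ (λ k → List.map (k ∷_) (compositions n (p ∸ k))) {upTo (suc p)} β∈)
  with γ , γ∈ , refl ← ∈-map⁻ (k ∷_) β∈k
  = trans (cong (k ℕ.+_) (∈-compositions⁻ (p ∸ k) γ γ∈))
          (m+[n∸m]≡n (s≤s⁻¹ (∈-upTo⁻ k∈)))

compositions-unique : ∀ n p → Unique (compositions n p)
compositions-unique zero    zero    = All.[] ∷ []
compositions-unique zero    (suc p) = []
compositions-unique (suc n) p       = AllPairs.concat⁺
  (All.map⁺ (All.universal
    (λ k → AllPairs.map⁺ (AllPairs.map (_∘ ∷-injectiveʳ) (compositions-unique n (p ∸ k))))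
    (upTo (suc p))))
  (AllPairs.map⁺ (AllPairs.map
    (λ k≢l → All.map⁺ (All.universal
      (λ _ → All.map⁺ (All.universal (λ _ → k≢l ∘ ∷-injectiveˡ) _)) _))
    (upTo⁺ (suc p))))

infixl 6 _⊕_

_⊕_ : ∀ {n} → Vector ℤ n → Vector ℤ n → Vector ℤ n
_⊕_ = zipWith ℤ._+_

natTuple : ∀ {n} → Vec ℕ n → Vector ℤ n
natTuple β i = + lookup β i

η : ∀ n → ℕ → Vector ℤ n
η n p = (λ j → + ⟦ j ⟧) ⊕ (λ j → if does (⟦ j ⟧ ℕ.≟ n) then + p else + 0)

module RowDet {c ℓ} (R : Ring c ℓ) where

  open Ring R
  open import Algebra.Definitions.RawSemiring (Semiring.rawSemiring semiring) using (product; _^_)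

  ∑ : ∀ {a} {A : Set a} → List A → (A → Carrier) → Carrier
  ∑ xs f = List.foldr _+_ 0# (List.map f xs)

  -- product is foldr _*_ 1#, so the factors occur in the order of the rows i.
  rowdet : ∀ {n} → (Fin n → Fin n → Carrier) → Carrier
  rowdet {n} A = ∑ (permutations n) λ σ →
    (- 1#) ^ inversions σ * product (λ i → A i (σ ⟨$⟩ʳ i))

  t : ∀ {n} → (ℤ → Fin n → Carrier) → Vector ℤ n → Carrier
  t h α = rowdet λ i j → h (α i ℤ.+ + ⟦ j ⟧) i

{-# OPTIONS --safe #-}
-- Read t as a function of the list of its column indices: c ↦ D f c, with
-- f i k = h (α i + k) i. Every term of a row-determinant contains each row and
-- each column exactly once, so adding β to the rows or to the columns gives the
-- same sum over all β with |β| = p. As a function of c, D f c is alternating even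
-- over a noncommutative ring. For consecutive columns a, a + 1 shifted by k, l with
-- k + l = m fixed, exchanging the two shifted columns is the involution
-- (k , l) ↦ (l + 1 , k ∸ 1) on the terms with k > 0, so these terms cancel and only
-- k = 0 survives. Applied to columns 1, 2, then 2, 3, and so on, this moves the
-- whole of p to the last column.
module Submission where

open import Defs
open import Algebra.Bundles using (Ring; Semiring)
import Algebra.Properties.CommutativeMonoid.Sum
import Algebra.Properties.CommutativeSemigroup
import Algebra.Properties.Ring
open import Data.Bool.Base using (Bool; true; false; _∧_; if_then_else_)
open import Data.Fin.Base using (Fin; zero; suc; toℕ; punchIn; inject₁)
open import Data.Fin.Permutation using (Permutation′; _⟨$⟩ʳ_; insert)
open import Data.Fin.Properties using (_<?_; toℕ-inject₁)
open import Data.Integer.Base as ℤ using (ℤ; +_)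
import Data.Integer.Properties as ℤ
open import Data.List.Base
  using (List; []; _∷_; _++_; length; map; filter; tabulate; cartesianProduct; allFin;
         applyUpTo; upTo; concatMap)
open import Data.List.Properties using (filter-++; length-++; map-tabulate; map-upTo)
open import Data.Nat.Base as ℕ using (ℕ; zero; suc; NonZero; _∸_)
import Data.Nat.Properties as ℕ
open import Data.Product.Base using (_×_; _,_; uncurry)
open import Data.Vec.Base as Vec using (Vec; lookup)
open import Data.Vec.Functional using (Vector)
open import Function.Base using (_∘_; id)
open import Level using (_⊔_)
open import Relation.Binary.PropositionalEquality as ≡ using (_≡_)
import Relation.Binary.Reasoning.Setoid
open import Relation.Nullary.Decidable using (does; _×-dec_)
open import Relation.Unary using (Pred; Decidable)

-- Inversions of a permutation built by insertion.

private
  module Sumℕ = Algebra.Properties.CommutativeMonoid.Sum ℕ.+-0-commutativeMonoid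

indicator : Bool → ℕ
indicator b = if b then 1 else 0

length-filter-tabulate : ∀ {a p} {A : Set a} {P : Pred A p} (P? : Decidable P) {n} (f : Fin n → A) →
  length (filter P? (tabulate f)) ≡ Sumℕ.sum (λ i → indicator (does (P? (f i))))
length-filter-tabulate P? {zero}  f = ≡.refl
length-filter-tabulate P? {suc n} f with does (P? (f zero))
... | true  = ≡.cong suc (length-filter-tabulate P? (f ∘ suc))
... | false = length-filter-tabulate P? (f ∘ suc)

length-filter-cartesianProduct : ∀ {a b p} {A : Set a} {B : Set b} {P : Pred (A × B) p}
  (P? : Decidable P) {m n} (f : Fin m → A) (g : Fin n → B) →
  length (filter P? (cartesianProduct (tabulate f) (tabulate g)))
    ≡ Sumℕ.sum (λ i → Sumℕ.sum (λ j → indicator (does (P? (f i , g j)))))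
length-filter-cartesianProduct P? {zero}  f g = ≡.refl
length-filter-cartesianProduct P? {suc m} f g = begin
  length (filter P? (row ++ rows))
    ≡⟨ ≡.cong length (filter-++ P? row rows) ⟩
  length (filter P? row ++ filter P? rows)
    ≡⟨ length-++ (filter P? row) ⟩
  length (filter P? row) ℕ.+ length (filter P? rows)
    ≡⟨ ≡.cong₂ ℕ._+_
         (≡.trans (≡.cong (length ∘ filter P?) (map-tabulate g (f zero ,_)))
                  (length-filter-tabulate P? (λ j → f zero , g j)))
         (length-filter-cartesianProduct P? (f ∘ suc) g) ⟩
  _ ∎
  where
  open ≡.≡-Reasoning
  row  = map (f zero ,_) (tabulate g)
  rows = cartesianProduct (tabulate (f ∘ suc)) (tabulate g)

inversions-sum : ∀ {n} (σ : Permutation′ n) →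
  inversions σ ≡ Sumℕ.sum (λ i → Sumℕ.sum (λ j →
    indicator (does (i <? j) ∧ does ((σ ⟨$⟩ʳ j) <? (σ ⟨$⟩ʳ i)))))
inversions-sum σ = length-filter-cartesianProduct
  (λ (i , j) → i <? j ×-dec (σ ⟨$⟩ʳ j) <? (σ ⟨$⟩ʳ i)) id id

punchIn-<? : ∀ {n} (j : Fin (suc n)) (k l : Fin n) →
  does (punchIn j k <? punchIn j l) ≡ does (k <? l)
punchIn-<? zero    k       l       = ≡.refl
punchIn-<? (suc j) zero    zero    = ≡.refl
punchIn-<? (suc j) zero    (suc l) = ≡.refl
punchIn-<? (suc j) (suc k) zero    = ≡.refl
punchIn-<? (suc j) (suc k) (suc l) = punchIn-<? j k l

-- `punchIn j` misses only `j`, so every value below `j` is counted exactly once.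
count-punchIn-< : ∀ {n} (j : Fin (suc n)) →
  Sumℕ.sum (λ k → indicator (does (punchIn j k <? j))) ≡ toℕ j
count-punchIn-< {n}     zero    = Sumℕ.sum-replicate-zero n
count-punchIn-< {suc n} (suc j) = ≡.cong suc (count-punchIn-< j)

-- Position `zero` is inverted with exactly those positions whose image lies below `j`; reindexing
-- by `σ` turns their number into `count-punchIn-<`. The other pairs keep their order because
-- `punchIn j` is increasing.
inversions-insert : ∀ {n} (j : Fin (suc n)) (σ : Permutation′ n) →
  inversions (insert zero j σ) ≡ toℕ j ℕ.+ inversions σ
inversions-insert j σ = begin
  inversions (insert zero j σ)
    ≡⟨ inversions-sum (insert zero j σ) ⟩
  Sumℕ.sum (λ k → indicator (does (punchIn j (σ ⟨$⟩ʳ k) <? j)))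
    ℕ.+ Sumℕ.sum (λ i → Sumℕ.sum (λ k → indicator
          (does (i <? k) ∧ does (punchIn j (σ ⟨$⟩ʳ k) <? punchIn j (σ ⟨$⟩ʳ i)))))
    ≡⟨ ≡.cong₂ ℕ._+_
         (≡.trans (≡.sym (Sumℕ.sum-permute (λ k → indicator (does (punchIn j k <? j))) σ))
                  (count-punchIn-< j))
         (Sumℕ.sum-cong-≗ λ i → Sumℕ.sum-cong-≗ λ k →
           ≡.cong (λ b → indicator (does (i <? k) ∧ b)) (punchIn-<? j (σ ⟨$⟩ʳ k) (σ ⟨$⟩ʳ i))) ⟩
  toℕ j ℕ.+ Sumℕ.sum (λ i → Sumℕ.sum (λ k → indicator
          (does (i <? k) ∧ does ((σ ⟨$⟩ʳ k) <? (σ ⟨$⟩ʳ i)))))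
    ≡⟨ ≡.cong (toℕ j ℕ.+_) (inversions-sum σ) ⟨
  toℕ j ℕ.+ inversions σ ∎
  where open ≡.≡-Reasoning

module _ {c ℓ} (R : Ring c ℓ) where

  open Ring R hiding (zero)
  open RowDet R
  open Algebra.Properties.Ring R
  open Algebra.Properties.CommutativeSemigroup +-commutativeSemigroup using (interchange)
  open import Algebra.Definitions.RawSemiring (Semiring.rawSemiring semiring) using (product; _^_)
  open Relation.Binary.Reasoning.Setoid setoid

  private
    +-sub-interchange : ∀ w x y z → (w + x) - (y + z) ≈ (w - y) + (x - z)
    +-sub-interchange w x y z = begin
      (w + x) - (y + z)     ≈⟨ +-congˡ (-‿+-comm y z) ⟨
      (w + x) + (- y - z)   ≈⟨ interchange w x (- y) (- z) ⟩
      (w - y) + (x - z)     ∎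

    sub-interchange : ∀ w x y z → (w - x) - (y - z) ≈ (w - y) - (x - z)
    sub-interchange w x y z = begin
      (w - x) - (y - z)       ≈⟨ +-sub-interchange w (- x) y (- z) ⟩
      (w - y) + (- x - - z)   ≈⟨ +-congˡ (-‿+-comm x (- z)) ⟩
      (w - y) - (x - z)       ∎

    -‿cong₂ : ∀ {w x y z} → w ≈ x → y ≈ z → w - y ≈ x - z
    -‿cong₂ p q = +-cong p (-‿cong q)

    0-0≈0 : 0# - 0# ≈ 0#
    0-0≈0 = -‿inverseʳ 0#

  -- Left-linear functionals and finite sums.

  -- Scalars act from the left, since the entry of the first row is the leftmost factor of each
  -- term. Subtraction is taken as primitive to match the recursion of `expand`.
  record Linear {i} {I : Set i} (L : (I → Carrier) → Carrier) : Set (c ⊔ ℓ ⊔ i) where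
    field
      resp  : ∀ {F G} → (∀ i → F i ≈ G i) → L F ≈ L G
      sub   : ∀ F G → L (λ i → F i - G i) ≈ L F - L G
      scale : ∀ x F → L (λ i → x * F i) ≈ x * L F

    vanish : ∀ {F} → (∀ i → F i ≈ 0#) → L F ≈ 0#
    vanish {F} F≈0 = begin
      L F                   ≈⟨ resp (λ i → trans (F≈0 i) (sym (zeroˡ (F i)))) ⟩
      L (λ i → 0# * F i)    ≈⟨ scale 0# F ⟩
      0# * L F              ≈⟨ zeroˡ (L F) ⟩
      0#                    ∎

    negate : ∀ {F G} → (∀ i → F i ≈ - G i) → L F ≈ - L G
    negate {F} {G} F≈-G = begin
      L F                    ≈⟨ resp (λ i → trans (F≈-G i) (sym (-1*x≈-x (G i)))) ⟩
      L (λ i → - 1# * G i)   ≈⟨ scale (- 1#) G ⟩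
      - 1# * L G             ≈⟨ -1*x≈-x (L G) ⟩
      - L G                  ∎

  open Linear

  ∑-linear : ∀ {a} {A : Set a} (xs : List A) → Linear (∑ xs)
  ∑-linear [] = record
    { resp  = λ _ → refl
    ; sub   = λ _ _ → sym 0-0≈0
    ; scale = λ x _ → sym (zeroʳ x)
    }
  ∑-linear (x ∷ xs) = record
    { resp  = λ F≈G → +-cong (F≈G x) (resp (∑-linear xs) F≈G)
    ; sub   = λ F G → trans (+-congˡ (sub (∑-linear xs) F G)) (sym (+-sub-interchange _ _ _ _))
    ; scale = λ y F → trans (+-congˡ (scale (∑-linear xs) y F)) (sym (distribˡ _ _ _))
    }

  ∑-++ : ∀ {a} {A : Set a} (xs ys : List A) F → ∑ (xs ++ ys) F ≈ ∑ xs F + ∑ ys F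
  ∑-++ []       ys F = sym (+-identityˡ _)
  ∑-++ (x ∷ xs) ys F = trans (+-congˡ (∑-++ xs ys F)) (sym (+-assoc _ _ _))

  ∑-map : ∀ {a b} {A : Set a} {B : Set b} (g : A → B) xs F → ∑ (map g xs) F ≈ ∑ xs (F ∘ g)
  ∑-map g []       F = refl
  ∑-map g (x ∷ xs) F = +-congˡ (∑-map g xs F)

  ∑-concatMap : ∀ {a b} {A : Set a} {B : Set b} (g : A → List B) xs F →
    ∑ (concatMap g xs) F ≈ ∑ xs (λ x → ∑ (g x) F)
  ∑-concatMap g []       F = refl
  ∑-concatMap g (x ∷ xs) F = trans (∑-++ (g x) _ F) (+-congˡ (∑-concatMap g xs F))

  -- Sums over pairs with a fixed total.

  -- The sum of F k l over all k + l = p.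
  conv : ℕ → (ℕ → ℕ → Carrier) → Carrier
  conv zero    F = F 0 0
  conv (suc p) F = F 0 (suc p) + conv p (F ∘ suc)

  conv-linear : ∀ p → Linear (λ F → conv p (λ k l → F (k , l)))
  conv-linear zero = record
    { resp  = λ F≈G → F≈G _
    ; sub   = λ _ _ → refl
    ; scale = λ _ _ → refl
    }
  conv-linear (suc p) = record
    { resp  = λ F≈G → +-cong (F≈G _) (resp (conv-linear p) (λ _ → F≈G _))
    ; sub   = λ F G → trans (+-congˡ (sub (conv-linear p) _ _)) (sym (+-sub-interchange _ _ _ _))
    ; scale = λ y F → trans (+-congˡ (scale (conv-linear p) y _)) (sym (distribˡ _ _ _))
    }

  conv-cong : ∀ p {F G} → (∀ k l → F k l ≈ G k l) → conv p F ≈ conv p G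
  conv-cong p F≈G = resp (conv-linear p) (uncurry F≈G)

  conv-+ : ∀ p F G → conv p (λ k l → F k l + G k l) ≈ conv p F + conv p G
  conv-+ zero    F G = refl
  conv-+ (suc p) F G = trans (+-congˡ (conv-+ p (F ∘ suc) (G ∘ suc))) (interchange _ _ _ _)

  conv-last : ∀ p F → conv (suc p) F ≈ conv p (λ k l → F k (suc l)) + F (suc p) 0
  conv-last zero    F = refl
  conv-last (suc p) F = trans (+-congˡ (conv-last p (F ∘ suc))) (sym (+-assoc _ _ _))

  -- Both sides sum over `k + l + r = p`. The induction splits off the terms with `k = 0`. On the
  -- right these head the inner sums; the inner sum at `l = suc p` consists of such a term alone and
  -- is separated by `conv-last`.
  conv-swap : ∀ p (F : ℕ → ℕ → ℕ → Carrier) →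
    conv p (λ k q → conv q (λ l r → F k l r)) ≈ conv p (λ l q → conv q (λ k r → F k l r))
  conv-swap zero    F = refl
  conv-swap (suc p) F = begin
    conv (suc p) (F 0) + conv p (λ k q → conv q (F (suc k)))
      ≈⟨ +-cong (conv-last p (F 0)) (conv-swap p (F ∘ suc)) ⟩
    (conv p (λ l q → F 0 l (suc q)) + F 0 (suc p) 0) + conv p (λ l q → conv q (λ k → F (suc k) l))
      ≈⟨ +-assoc _ _ _ ⟩
    conv p (λ l q → F 0 l (suc q)) + (F 0 (suc p) 0 + conv p (λ l q → conv q (λ k → F (suc k) l)))
      ≈⟨ +-congˡ (+-comm _ _) ⟩
    conv p (λ l q → F 0 l (suc q)) + (conv p (λ l q → conv q (λ k → F (suc k) l)) + F 0 (suc p) 0)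
      ≈⟨ +-assoc _ _ _ ⟨
    (conv p (λ l q → F 0 l (suc q)) + conv p (λ l q → conv q (λ k → F (suc k) l))) + F 0 (suc p) 0
      ≈⟨ +-congʳ (conv-+ p _ _) ⟨
    conv p (λ l q → conv (suc q) (λ k → F k l)) + F 0 (suc p) 0
      ≈⟨ conv-last p (λ l q → conv q (λ k → F k l)) ⟨
    conv (suc p) (λ l q → conv q (λ k → F k l)) ∎

  conv-assoc : ∀ p (F : ℕ → ℕ → ℕ → Carrier) →
    conv p (λ k q → conv q (λ l r → F k l r)) ≈ conv p (λ m r → conv m (λ k l → F k l r))
  conv-assoc zero    F = refl
  conv-assoc (suc p) F = begin
    (F 0 0 (suc p) + conv p (F 0 ∘ suc)) + conv p (λ k q → conv q (F (suc k)))
      ≈⟨ +-assoc _ _ _ ⟩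
    F 0 0 (suc p) + (conv p (F 0 ∘ suc) + conv p (λ k q → conv q (F (suc k))))
      ≈⟨ +-congˡ (+-congˡ (conv-assoc p (F ∘ suc))) ⟩
    F 0 0 (suc p) + (conv p (F 0 ∘ suc) + conv p (λ m r → conv m (λ k l → F (suc k) l r)))
      ≈⟨ +-congˡ (conv-+ p _ _) ⟨
    conv (suc p) (λ m r → conv m (λ k l → F k l r)) ∎

  -- The first and last terms cancel, and removing them lowers the total by two; a middle term, if
  -- there is one, lies on the diagonal.
  conv-alternating : ∀ p {φ} → (∀ x y → φ x y ≈ - φ y x) → (∀ x → φ x x ≈ 0#) → conv p φ ≈ 0#
  conv-alternating zero {φ} anti diag = diag 0
  conv-alternating (suc zero) {φ} anti diag = trans (+-congʳ (anti 0 1)) (-‿inverseˡ (φ 1 0))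
  conv-alternating (suc (suc p)) {φ} anti diag = begin
    φ 0 (2 ℕ.+ p) + conv (suc p) (φ ∘ suc)
      ≈⟨ +-congˡ (conv-last p (φ ∘ suc)) ⟩
    φ 0 (2 ℕ.+ p) + (conv p (λ k l → φ (suc k) (suc l)) + φ (2 ℕ.+ p) 0)
      ≈⟨ +-congˡ (trans (+-congʳ (conv-alternating p (λ x y → anti _ _) (λ x → diag _))) (+-identityˡ _)) ⟩
    φ 0 (2 ℕ.+ p) + φ (2 ℕ.+ p) 0
      ≈⟨ +-congʳ (anti _ _) ⟩
    - φ (2 ℕ.+ p) 0 + φ (2 ℕ.+ p) 0
      ≈⟨ -‿inverseˡ _ ⟩
    0# ∎

  ∑-upTo : ∀ p (G : ℕ → ℕ → Carrier) → ∑ (upTo (suc p)) (λ k → G k (p ∸ k)) ≈ conv p G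
  ∑-upTo zero    G = +-identityʳ _
  ∑-upTo (suc p) G = +-congˡ (begin
    ∑ (applyUpTo suc (suc p)) (λ k → G k (suc p ∸ k))
      ≡⟨ ≡.cong (λ ks → ∑ ks (λ k → G k (suc p ∸ k))) (map-upTo suc (suc p)) ⟨
    ∑ (map suc (upTo (suc p))) (λ k → G k (suc p ∸ k))
      ≈⟨ ∑-map suc (upTo (suc p)) _ ⟩
    ∑ (upTo (suc p)) (λ k → G (suc k) (p ∸ k))
      ≈⟨ ∑-upTo p (G ∘ suc) ⟩
    conv p (G ∘ suc) ∎)

  ∑-compositions : ∀ n p (F : Vec ℕ (suc n) → Carrier) →
    ∑ (compositions (suc n) p) F ≈ conv p (λ k q → ∑ (compositions n q) (λ β → F (k Vec.∷ β)))
  ∑-compositions n p F = begin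
    ∑ (compositions (suc n) p) F
      ≈⟨ ∑-concatMap (λ k → map (k Vec.∷_) (compositions n (p ∸ k))) (upTo (suc p)) F ⟩
    ∑ (upTo (suc p)) (λ k → ∑ (map (k Vec.∷_) (compositions n (p ∸ k))) F)
      ≈⟨ resp (∑-linear (upTo (suc p))) (λ k → ∑-map (k Vec.∷_) (compositions n (p ∸ k)) F) ⟩
    ∑ (upTo (suc p)) (λ k → ∑ (compositions n (p ∸ k)) (λ β → F (k Vec.∷ β)))
      ≈⟨ ∑-upTo p _ ⟩
    conv p (λ k q → ∑ (compositions n q) (λ β → F (k Vec.∷ β))) ∎

  -- Column shifts and expansion along the first row.

  -- The sum of Φ (c + β) over all β with |β| = p.
  shifts : List ℕ → ℕ → (List ℕ → Carrier) → Carrier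
  shifts []      zero    Φ = Φ []
  shifts []      (suc p) Φ = 0#
  shifts (x ∷ c) p       Φ = conv p (λ k q → shifts c q (λ d → Φ (x ℕ.+ k ∷ d)))

  shifts-linear : ∀ c p → Linear (shifts c p)
  shifts-linear [] zero = record
    { resp  = λ F≈G → F≈G _
    ; sub   = λ _ _ → refl
    ; scale = λ _ _ → refl
    }
  shifts-linear [] (suc p) = record
    { resp  = λ _ → refl
    ; sub   = λ _ _ → sym 0-0≈0
    ; scale = λ x _ → sym (zeroʳ x)
    }
  shifts-linear (x ∷ c) p = record
    { resp  = λ F≈G → conv-cong p (λ k q → resp (shifts-linear c q) (λ _ → F≈G _))
    ; sub   = λ F G → trans (conv-cong p (λ k q → sub (shifts-linear c q) _ _)) (sub (conv-linear p) _ _)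
    ; scale = λ y F → trans (conv-cong p (λ k q → scale (shifts-linear c q) y _)) (scale (conv-linear p) y _)
    }

  -- The alternating sum of g y d over the ways to remove one entry y from a list,
  -- leaving d: Laplace expansion along the first row.
  expand : (ℕ → List ℕ → Carrier) → List ℕ → Carrier
  expand g []      = 0#
  expand g (x ∷ c) = g x c - expand (λ y d → g y (x ∷ d)) c

  expand-linear : ∀ c → Linear (λ g → expand (λ y d → g (y , d)) c)
  expand-linear [] = record
    { resp  = λ _ → refl
    ; sub   = λ _ _ → sym 0-0≈0
    ; scale = λ x _ → sym (zeroʳ x)
    }
  expand-linear (x ∷ c) = record
    { resp  = λ F≈G → -‿cong₂ (F≈G _) (resp (expand-linear c) (λ _ → F≈G _))
    ; sub   = λ F G → trans (-‿cong₂ refl (sub (expand-linear c) _ _)) (sub-interchange _ _ _ _)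
    ; scale = λ y F → trans (-‿cong₂ refl (scale (expand-linear c) y _)) (sym (x[y-z]≈xy-xz _ _ _))
    }

  expand-cong : ∀ {g g′} → (∀ y d → g y d ≈ g′ y d) → ∀ c → expand g c ≈ expand g′ c
  expand-cong g≈g′ c = resp (expand-linear c) (uncurry g≈g′)

  -- An expansion is built from `0#` and subtraction alone, and `L` preserves both.
  expand-comm : ∀ {i} {I : Set i} {L : (I → Carrier) → Carrier} → Linear L →
    ∀ (g : I → ℕ → List ℕ → Carrier) c →
    expand (λ y d → L (λ i → g i y d)) c ≈ L (λ i → expand (g i) c)
  expand-comm linear g []      = sym (vanish linear (λ _ → refl))
  expand-comm linear g (x ∷ c) = trans
    (-‿cong₂ refl (expand-comm linear (λ i y d → g i y (x ∷ d)) c))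
    (sym (sub linear _ _))

  -- On the left the removed entry receives its shift `k` before the remaining entries do. If `x` is
  -- removed, the two sides agree at once; otherwise the shift `k` of `y` and the shift `l` of `x`
  -- are chosen in opposite orders, which `conv-swap` reconciles.
  shifts-expand : ∀ c p g →
    conv p (λ k q → expand (λ y d → shifts d q (g (y ℕ.+ k))) c) ≈ shifts c p (expand g)
  shifts-expand []      zero    g = refl
  shifts-expand []      (suc p) g = vanish (conv-linear (suc p)) (λ _ → refl)
  shifts-expand (x ∷ c) p       g = begin
    conv p (λ k q → shifts c q (g (x ℕ.+ k)) - expand (λ y d → shifts (x ∷ d) q (g (y ℕ.+ k))) c)
      ≈⟨ sub (conv-linear p) _ _ ⟩
    conv p (λ k q → shifts c q (g (x ℕ.+ k)))
      - conv p (λ k q → expand (λ y d → conv q (λ l r → shifts d r (λ e → g (y ℕ.+ k) (x ℕ.+ l ∷ e)))) c)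
      ≈⟨ -‿cong₂ refl (conv-cong p (λ k q → expand-comm (conv-linear q)
           (λ (l , r) y d → shifts d r (λ e → g (y ℕ.+ k) (x ℕ.+ l ∷ e))) c)) ⟩
    conv p (λ k q → shifts c q (g (x ℕ.+ k)))
      - conv p (λ k q → conv q (λ l r → expand (λ y d → shifts d r (λ e → g (y ℕ.+ k) (x ℕ.+ l ∷ e))) c))
      ≈⟨ -‿cong₂ refl (conv-swap p _) ⟩
    conv p (λ k q → shifts c q (g (x ℕ.+ k)))
      - conv p (λ l q → conv q (λ k r → expand (λ y d → shifts d r (λ e → g (y ℕ.+ k) (x ℕ.+ l ∷ e))) c))
      ≈⟨ -‿cong₂ refl (conv-cong p (λ l q → shifts-expand c q (λ y e → g y (x ℕ.+ l ∷ e)))) ⟩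
    conv p (λ k q → shifts c q (g (x ℕ.+ k)))
      - conv p (λ l q → shifts c q (expand (λ y e → g y (x ℕ.+ l ∷ e))))
      ≈⟨ sub (conv-linear p) _ _ ⟨
    conv p (λ k q → shifts c q (g (x ℕ.+ k)) - shifts c q (expand (λ y e → g y (x ℕ.+ k ∷ e))))
      ≈⟨ conv-cong p (λ k q → sub (shifts-linear c q) _ _) ⟨
    shifts (x ∷ c) p (expand g) ∎

  -- Row-determinants as functions of their column indices.

  -- Columns form a list of arbitrary naturals, so they can be shifted, repeated and removed freely.
  -- A list whose length is not `n` gives `0#`.
  det : ∀ {n} → (Fin n → ℕ → Carrier) → List ℕ → Carrier
  det {zero}  f []      = 1#
  det {zero}  f (_ ∷ _) = 0#
  det {suc n} f c       = expand (λ y d → f zero y * det (f ∘ suc) d) c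

  -- This exchanges row shifts for column shifts. The shift `k` of the first row becomes the shift
  -- of the column `y` used in that row, the induction hypothesis treats the minor with the
  -- remaining total `q`, and `shifts-expand` reassembles the columns.
  det-shifts : ∀ n p (f : Fin n → ℕ → Carrier) c →
    ∑ (compositions n p) (λ β → det (λ i k → f i (k ℕ.+ lookup β i)) c) ≈ shifts c p (det f)
  det-shifts zero    zero    f []      = +-identityʳ _
  det-shifts zero    (suc p) f []      = refl
  det-shifts zero    p       f (x ∷ c) = trans
    (vanish (∑-linear (compositions 0 p)) (λ _ → refl))
    (sym (vanish (conv-linear p) (λ (_ , q) → vanish (shifts-linear c q) (λ _ → refl))))
  det-shifts (suc n) p       f c       = begin
    ∑ (compositions (suc n) p) (λ β → det (λ i k → f i (k ℕ.+ lookup β i)) c)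
      ≈⟨ ∑-compositions n p _ ⟩
    conv p (λ k q → ∑ (compositions n q) (λ β →
      expand (λ y d → f zero (y ℕ.+ k) * det (λ i k → f (suc i) (k ℕ.+ lookup β i)) d) c))
      ≈⟨ conv-cong p (λ k q → expand-comm (∑-linear (compositions n q)) _ c) ⟨
    conv p (λ k q → expand (λ y d → ∑ (compositions n q) (λ β →
      f zero (y ℕ.+ k) * det (λ i k → f (suc i) (k ℕ.+ lookup β i)) d)) c)
      -- The first-row entry is the left factor and depends only on `k`, so it leaves and re-enters
      -- the sums by `scale`.
      ≈⟨ conv-cong p (λ k q → expand-cong (λ y d → begin
           _ ≈⟨ scale (∑-linear (compositions n q)) _ _ ⟩
           _ ≈⟨ *-congˡ (det-shifts n q (f ∘ suc) d) ⟩
           _ ≈⟨ scale (shifts-linear d q) _ _ ⟨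
           shifts d q (λ e → f zero (y ℕ.+ k) * det (f ∘ suc) e) ∎) c) ⟩
    conv p (λ k q → expand (λ y d → shifts d q (λ e → f zero (y ℕ.+ k) * det (f ∘ suc) e)) c)
      ≈⟨ shifts-expand c p (λ y d → f zero y * det (f ∘ suc) d) ⟩
    shifts c p (det f) ∎

  -- Alternation in the columns.

  -- `equal` is a separate field because `swap` only yields that twice the value is zero, and `R`
  -- may have 2-torsion.
  record Alternating (Φ : List ℕ → Carrier) : Set ℓ where
    field
      swap  : ∀ us x y vs → Φ (us ++ x ∷ y ∷ vs) ≈ - Φ (us ++ y ∷ x ∷ vs)
      equal : ∀ us x vs → Φ (us ++ x ∷ x ∷ vs) ≈ 0#

  open Alternating

  fix-head : ∀ {Φ} → Alternating Φ → ∀ x → Alternating (Φ ∘ (x ∷_))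
  fix-head alt x = record
    { swap  = λ us → swap alt (x ∷ us)
    ; equal = λ us → equal alt (x ∷ us)
    }

  -- The terms removing `x` and `y` trade places and carry opposite signs; every other term changes
  -- sign because `g` is alternating in the entries that remain.
  expand-swap : ∀ {g} → (∀ y → Alternating (g y)) → ∀ us x y vs →
    expand g (us ++ x ∷ y ∷ vs) ≈ - expand g (us ++ y ∷ x ∷ vs)
  expand-swap {g} alt [] x y vs = begin
    a - (b - e)       ≈⟨ -‿cong₂ (sym (-‿involutive a)) refl ⟩
    - - a - (b - e)   ≈⟨ +-comm _ _ ⟩
    - (b - e) - - a   ≈⟨ -‿+-comm (b - e) (- a) ⟩
    - (b - e - a)     ≈⟨ -‿cong (begin
      b - e - a           ≈⟨ +-assoc b (- e) (- a) ⟩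
      b + (- e - a)       ≈⟨ +-congˡ (+-cong (sym e′≈-e) refl) ⟩
      b + (e′ - a)        ≈⟨ +-congˡ (+-comm e′ (- a)) ⟩
      b + (- a + e′)      ≈⟨ +-congˡ (+-congˡ (sym (-‿involutive e′))) ⟩
      b + (- a - - e′)    ≈⟨ +-congˡ (-‿+-comm a (- e′)) ⟩
      b - (a - e′)        ∎) ⟩
    - (b - (a - e′))  ∎
    where
    a  = g x (y ∷ vs)
    b  = g y (x ∷ vs)
    e  = expand (λ z d → g z (x ∷ y ∷ d)) vs
    e′ = expand (λ z d → g z (y ∷ x ∷ d)) vs
    e′≈-e : e′ ≈ - e
    e′≈-e = negate (expand-linear vs) (λ (z , d) → swap (alt z) [] y x d)
  expand-swap {g} alt (u ∷ us) x y vs = trans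
    (-‿cong₂ (swap (alt u) us x y vs) (expand-swap (λ z → fix-head (alt z) u) us x y vs))
    (-‿+-comm _ _)

  -- Removing either copy of `x` leaves the same list, with opposite signs; every other term still
  -- contains both copies and vanishes.
  expand-equal : ∀ {g} → (∀ y → Alternating (g y)) → ∀ us x vs →
    expand g (us ++ x ∷ x ∷ vs) ≈ 0#
  expand-equal {g} alt [] x vs = begin
    a - (a - e)   ≈⟨ -‿cong₂ refl (-‿cong₂ refl (vanish (expand-linear vs) (λ (z , d) → equal (alt z) [] x d))) ⟩
    a - (a - 0#)  ≈⟨ -‿cong₂ refl (trans (+-congˡ -0#≈0#) (+-identityʳ a)) ⟩
    a - a         ≈⟨ -‿inverseʳ a ⟩
    0#            ∎
    where
    a = g x (x ∷ vs)
    e = expand (λ z d → g z (x ∷ x ∷ d)) vs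
  expand-equal {g} alt (u ∷ us) x vs = trans
    (-‿cong₂ (equal (alt u) us x vs) (expand-equal (λ z → fix-head (alt z) u) us x vs))
    0-0≈0

  expand-alternating : ∀ {g} → (∀ y → Alternating (g y)) → Alternating (expand g)
  expand-alternating alt = record { swap = expand-swap alt ; equal = expand-equal alt }

  -- Commutativity never enters: exchanging columns leaves the factors in row order.
  det-alternating : ∀ {n} (f : Fin n → ℕ → Carrier) → Alternating (det f)
  det-alternating {zero} f = record
    { swap  = λ { [] x y vs → sym -0#≈0# ; (_ ∷ _) x y vs → sym -0#≈0# }
    ; equal = λ { [] x vs → refl ; (_ ∷ _) x vs → refl }
    }
  det-alternating {suc n} f = expand-alternating λ y → record
    { swap  = λ us x z vs → trans (*-congˡ (swap rec us x z vs)) (sym (-‿distribʳ-* _ _))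
    ; equal = λ us x vs → trans (*-congˡ (equal rec us x vs)) (zeroʳ _)
    }
    where rec = det-alternating (f ∘ suc)

  -- Moving the total shift to the last of several consecutive columns.

  conv-consecutive : ∀ m a {ψ : ℕ → ℕ → Carrier} →
    (∀ x y → ψ x y ≈ - ψ y x) → (∀ x → ψ x x ≈ 0#) →
    conv m (λ k l → ψ (a ℕ.+ k) (suc a ℕ.+ l)) ≈ ψ (a ℕ.+ 0) (suc a ℕ.+ m)
  conv-consecutive zero    a     anti diag = refl
  conv-consecutive (suc m) a {ψ} anti diag = begin
    ψ (a ℕ.+ 0) (suc a ℕ.+ suc m) + conv m (λ k l → ψ (a ℕ.+ suc k) (suc a ℕ.+ l))
      -- Past `k = 0` both arguments start from `suc a`, so the remaining sum is alternating.
      ≈⟨ +-congˡ (conv-cong m (λ k l → reflexive (≡.cong (λ x → ψ x (suc a ℕ.+ l)) (ℕ.+-suc a k)))) ⟩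
    ψ (a ℕ.+ 0) (suc a ℕ.+ suc m) + conv m (λ k l → ψ (suc a ℕ.+ k) (suc a ℕ.+ l))
      ≈⟨ +-congˡ (conv-alternating m (λ _ _ → anti _ _) (λ _ → diag _)) ⟩
    ψ (a ℕ.+ 0) (suc a ℕ.+ suc m) + 0#
      ≈⟨ +-identityʳ _ ⟩
    ψ (a ℕ.+ 0) (suc a ℕ.+ suc m) ∎

  -- `conv-assoc` groups the first two columns by their joint shift `m`, and `conv-consecutive` puts
  -- all of `m` on the second. The first column is then fixed, and the columns after it are again
  -- consecutive.
  shifts-consecutive : ∀ n p (c : Fin (suc n) → ℕ) → (∀ i → c (suc i) ≡ suc (c (inject₁ i))) →
    ∀ {Φ} → Alternating Φ →
    shifts (tabulate c) p Φ ≈ Φ (tabulate (λ j → c j ℕ.+ (if does (toℕ j ℕ.≟ n) then p else 0)))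
  shifts-consecutive zero p c c-suc {Φ} alt = singleton p _
    where
    -- `x` varies because each step of the induction passes one unit of shift from `p` to `x`.
    singleton : ∀ p x → shifts (x ∷ []) p Φ ≈ Φ (x ℕ.+ p ∷ [])
    singleton zero    x = refl
    singleton (suc p) x = begin
      0# + conv p (λ k q → shifts [] q (λ d → Φ (x ℕ.+ suc k ∷ d)))
        ≈⟨ +-identityˡ _ ⟩
      conv p (λ k q → shifts [] q (λ d → Φ (x ℕ.+ suc k ∷ d)))
        ≈⟨ conv-cong p (λ k q → resp (shifts-linear [] q) (λ d →
             reflexive (≡.cong (λ y → Φ (y ∷ d)) (ℕ.+-suc x k)))) ⟩
      shifts (suc x ∷ []) p Φ
        ≈⟨ singleton p (suc x) ⟩
      Φ (suc x ℕ.+ p ∷ [])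
        ≡⟨ ≡.cong (λ y → Φ (y ∷ [])) (ℕ.+-suc x p) ⟨
      Φ (x ℕ.+ suc p ∷ []) ∎
  shifts-consecutive (suc n) p c c-suc {Φ} alt = begin
    conv p (λ k q → conv q (λ l r → shifts vs r (λ d → Φ (c zero ℕ.+ k ∷ c (suc zero) ℕ.+ l ∷ d))))
      ≈⟨ conv-assoc p _ ⟩
    conv p (λ m r → conv m (λ k l → shifts vs r (λ d → Φ (c zero ℕ.+ k ∷ c (suc zero) ℕ.+ l ∷ d))))
      ≈⟨ conv-cong p step ⟩
    conv p (λ m r → shifts vs r (λ d → Φ (c zero ℕ.+ 0 ∷ c (suc zero) ℕ.+ m ∷ d)))
      -- The unsimplified `c zero ℕ.+ 0` is what the conditional in the goal computes to at `zero`.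
      ≈⟨ shifts-consecutive n p (c ∘ suc) (c-suc ∘ suc) (fix-head alt (c zero ℕ.+ 0)) ⟩
    Φ (tabulate (λ j → c j ℕ.+ (if does (toℕ j ℕ.≟ suc n) then p else 0))) ∎
    where
    vs = tabulate (λ i → c (suc (suc i)))
    step : ∀ m r →
      conv m (λ k l → shifts vs r (λ d → Φ (c zero ℕ.+ k ∷ c (suc zero) ℕ.+ l ∷ d)))
        ≈ shifts vs r (λ d → Φ (c zero ℕ.+ 0 ∷ c (suc zero) ℕ.+ m ∷ d))
    step m r rewrite c-suc zero = conv-consecutive m (c zero)
      {λ x y → shifts vs r (λ d → Φ (x ∷ y ∷ d))}
      (λ x y → negate (shifts-linear vs r) (swap alt [] x y))
      (λ x → vanish (shifts-linear vs r) (equal alt [] x))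

  -- Laplace expansion of `rowdet` and its agreement with `det`.

  -- Powers of `- 1#` are central, so the sign of the minor can pass the first-row entry `x`.
  [-1]^-+-* : ∀ m n x y →
    (- 1#) ^ (m ℕ.+ n) * (x * y) ≈ (- 1#) ^ m * (x * ((- 1#) ^ n * y))
  [-1]^-+-* (suc m) n x y = begin
    (- 1# * (- 1#) ^ (m ℕ.+ n)) * (x * y)          ≈⟨ *-assoc _ _ _ ⟩
    - 1# * ((- 1#) ^ (m ℕ.+ n) * (x * y))          ≈⟨ *-congˡ ([-1]^-+-* m n x y) ⟩
    - 1# * ((- 1#) ^ m * (x * ((- 1#) ^ n * y)))   ≈⟨ *-assoc _ _ _ ⟨
    (- 1# * (- 1#) ^ m) * (x * ((- 1#) ^ n * y))   ∎
  [-1]^-+-* zero zero x y = *-congˡ (*-congˡ (sym (*-identityˡ y)))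
  [-1]^-+-* zero (suc n) x y = begin
    (- 1# * (- 1#) ^ n) * (x * y)          ≈⟨ *-assoc _ _ _ ⟩
    - 1# * ((- 1#) ^ n * (x * y))          ≈⟨ -1*x≈-x _ ⟩
    - ((- 1#) ^ n * (x * y))               ≈⟨ -‿cong ([-1]^-+-* zero n x y) ⟩
    - (1# * (x * ((- 1#) ^ n * y)))        ≈⟨ -‿distribʳ-* _ _ ⟩
    1# * - (x * ((- 1#) ^ n * y))          ≈⟨ *-congˡ (-‿distribʳ-* _ _) ⟩
    1# * (x * - ((- 1#) ^ n * y))          ≈⟨ *-congˡ (*-congˡ (-1*x≈-x _)) ⟨
    1# * (x * (- 1# * ((- 1#) ^ n * y)))   ≈⟨ *-congˡ (*-congˡ (*-assoc _ _ _)) ⟨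
    1# * (x * ((- 1# * (- 1#) ^ n) * y))   ∎

  -- Permutations are grouped by the image `j` of `zero`; `inversions-insert` splits the sign into
  -- that of `j` and that of the minor.
  rowdet-expand : ∀ {n} (A : Fin (suc n) → Fin (suc n) → Carrier) →
    rowdet A ≈ ∑ (allFin (suc n)) (λ j →
      (- 1#) ^ toℕ j * (A zero j * rowdet (λ i k → A (suc i) (punchIn j k))))
  rowdet-expand {n} A = begin
    rowdet A
      ≈⟨ ∑-concatMap (λ j → map (insert zero j) (permutations n)) (allFin (suc n)) term ⟩
    ∑ (allFin (suc n)) (λ j → ∑ (map (insert zero j) (permutations n)) term)
      ≈⟨ resp (∑-linear (allFin (suc n))) (λ j → begin
           ∑ (map (insert zero j) (permutations n)) term
             ≈⟨ ∑-map (insert zero j) (permutations n) term ⟩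
           ∑ (permutations n) (λ σ → term (insert zero j σ))
             ≈⟨ resp (∑-linear (permutations n)) (λ σ → trans
                  (*-congʳ (reflexive (≡.cong ((- 1#) ^_) (inversions-insert j σ))))
                  ([-1]^-+-* (toℕ j) (inversions σ) _ _)) ⟩
           ∑ (permutations n) (λ σ → (- 1#) ^ toℕ j * (A zero j * minor-term j σ))
             ≈⟨ scale (∑-linear (permutations n)) _ _ ⟩
           (- 1#) ^ toℕ j * ∑ (permutations n) (λ σ → A zero j * minor-term j σ)
             ≈⟨ *-congˡ (scale (∑-linear (permutations n)) _ _) ⟩
           (- 1#) ^ toℕ j * (A zero j * rowdet (λ i k → A (suc i) (punchIn j k))) ∎) ⟩
    _ ∎
    where
    term : Permutation′ (suc n) → Carrier
    term σ = (- 1#) ^ inversions σ * product (λ i → A i (σ ⟨$⟩ʳ i))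
    minor-term : Fin (suc n) → Permutation′ n → Carrier
    minor-term j σ = (- 1#) ^ inversions σ * product (λ i → A (suc i) (punchIn j (σ ⟨$⟩ʳ i)))

  -- Each nested subtraction in `expand` contributes one factor `- 1#`.
  expand-tabulate : ∀ {n} (c : Fin (suc n) → ℕ) g →
    expand g (tabulate c)
      ≈ ∑ (allFin (suc n)) (λ j → (- 1#) ^ toℕ j * g (c j) (tabulate (c ∘ punchIn j)))
  expand-tabulate {zero}  c g = +-cong (sym (*-identityˡ _)) -0#≈0#
  expand-tabulate {suc n} c g = +-cong (sym (*-identityˡ _)) (begin
    - expand (λ y d → g y (c zero ∷ d)) (tabulate (c ∘ suc))
      ≈⟨ -‿cong (expand-tabulate (c ∘ suc) (λ y d → g y (c zero ∷ d))) ⟩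
    - ∑ (allFin (suc n)) (λ j → (- 1#) ^ toℕ j * G (suc j))
      ≈⟨ negate (∑-linear (allFin (suc n))) (λ j → trans (*-assoc _ _ _) (-1*x≈-x _)) ⟨
    ∑ (allFin (suc n)) (λ j → (- 1#) ^ toℕ (suc j) * G (suc j))
      ≈⟨ ∑-map suc (allFin (suc n)) _ ⟨
    ∑ (map suc (allFin (suc n))) (λ j → (- 1#) ^ toℕ j * G j)
      ≡⟨ ≡.cong (λ js → ∑ js (λ j → (- 1#) ^ toℕ j * G j)) (map-tabulate id suc) ⟩
    ∑ (tabulate suc) (λ j → (- 1#) ^ toℕ j * G j) ∎)
    where
    G : Fin (suc (suc n)) → Carrier
    G j = g (c j) (tabulate (c ∘ punchIn j))

  rowdet≈det : ∀ {n} (f : Fin n → ℕ → Carrier) (c : Fin n → ℕ) →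
    rowdet (λ i j → f i (c j)) ≈ det f (tabulate c)
  rowdet≈det {zero}  f c = trans (+-identityʳ _) (*-identityˡ _)
  rowdet≈det {suc n} f c = begin
    rowdet (λ i j → f i (c j))
      ≈⟨ rowdet-expand (λ i j → f i (c j)) ⟩
    ∑ (allFin (suc n)) (λ j →
      (- 1#) ^ toℕ j * (f zero (c j) * rowdet (λ i k → f (suc i) (c (punchIn j k)))))
      ≈⟨ resp (∑-linear (allFin (suc n))) (λ j →
           *-congˡ (*-congˡ (rowdet≈det (f ∘ suc) (c ∘ punchIn j)))) ⟩
    ∑ (allFin (suc n)) (λ j →
      (- 1#) ^ toℕ j * (f zero (c j) * det (f ∘ suc) (tabulate (c ∘ punchIn j))))
      ≈⟨ expand-tabulate c (λ y d → f zero y * det (f ∘ suc) d) ⟨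
    det f (tabulate c) ∎

  rowdet-cong : ∀ {n} {A B : Fin n → Fin n → Carrier} → (∀ i j → A i j ≡ B i j) →
    rowdet A ≈ rowdet B
  rowdet-cong {n} A≡B = resp (∑-linear (permutations n)) λ σ →
    *-congˡ (product-cong λ i → reflexive (A≡B i (σ ⟨$⟩ʳ i)))
    where
    product-cong : ∀ {n} {u v : Fin n → Carrier} → (∀ i → u i ≈ v i) → product u ≈ product v
    product-cong {zero}  u≈v = refl
    product-cong {suc n} u≈v = *-cong (u≈v zero) (product-cong (u≈v ∘ suc))

theorem2p1 : ∀ {c ℓ} (R : Ring c ℓ) (n : ℕ) .{{_ : NonZero n}} (p : ℕ)
    (h : ℤ → Fin n → Ring.Carrier R) (α : Vector ℤ n) →
    let open Ring R using (_≈_)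
        open RowDet R
    in ∑ (compositions n p) (λ β → t h (α ⊕ natTuple β))
         ≈ rowdet (λ i j → h (α i ℤ.+ η n p j) i)
theorem2p1 R n@(suc m) p h α = begin
  ∑ (compositions n p) (λ β → t h (α ⊕ natTuple β))
    ≈⟨ Linear.resp (∑-linear R (compositions n p)) (λ β → trans
         (rowdet-cong R (λ i j → ≡.cong (λ z → h z i) (row-shift i j (lookup β i))))
         (rowdet≈det R {n} (λ i k → f i (k ℕ.+ lookup β i)) ⟦_⟧)) ⟩
  ∑ (compositions n p) (λ β → det R (λ i k → f i (k ℕ.+ lookup β i)) columns)
    ≈⟨ det-shifts R n p f columns ⟩
  shifts R columns p (det R f)
    -- The 2 combines the offset in `⟦_⟧` with the step to the next column.
    ≈⟨ shifts-consecutive R m p ⟦_⟧ (λ i → ≡.cong (2 ℕ.+_) (≡.sym (toℕ-inject₁ i))) (det-alternating R f) ⟩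
  det R f (tabulate η′)
    ≈⟨ rowdet≈det R f η′ ⟨
  rowdet (λ i j → f i (η′ j))
    ≈⟨ rowdet-cong R (λ i j → ≡.cong (λ z → h (α i ℤ.+ z) i) (η′≡η j)) ⟩
  rowdet (λ i j → h (α i ℤ.+ η n p j) i) ∎
  where
  open Ring R using (trans; setoid)
  open RowDet R
  open Relation.Binary.Reasoning.Setoid setoid

  columns : List ℕ
  columns = tabulate {n = n} ⟦_⟧

  f : Fin n → ℕ → Ring.Carrier R
  f i k = h (α i ℤ.+ + k) i

  η′ : Fin n → ℕ
  η′ j = ⟦ j ⟧ ℕ.+ (if does (toℕ j ℕ.≟ m) then p else 0)

  row-shift : ∀ i (j : Fin n) b → (α i ℤ.+ + b) ℤ.+ + ⟦ j ⟧ ≡ α i ℤ.+ + (⟦ j ⟧ ℕ.+ b)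
  row-shift i j b = ≡.trans (ℤ.+-assoc (α i) (+ b) (+ ⟦ j ⟧))
    (≡.cong (λ k → α i ℤ.+ + k) (ℕ.+-comm b ⟦ j ⟧))

  η′≡η : ∀ j → + η′ j ≡ η n p j
  -- The test in `η` compares `⟦ j ⟧` with `suc m` and reduces to this one, so one case split
  -- settles both.
  η′≡η j with does (toℕ j ℕ.≟ m)
  ... | true  = ≡.refl
  ... | false = ≡.refl
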